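{- $\langle\forall^\to\exists\forall\rangle\not\le_{\sf m}\langle\forall\exists\forall\rangle$.
   Context: Quantifiers range over $\omega$. Instances are (tuples of) total computable functions, i.e. computable elements of $\omega^\omega$; spaces such as $\omega\times\omega^\omega$, $(\omega^\omega)^\omega$ are identified with $\omega^\omega$ by computable pairing. $0^\infty$ is the constantly zero sequence. $\langle\forall^\to\exists\forall\rangle$ is the formula, for instances $(p,x)=(p_n,x^n_m)_{n,m\in\omega}$ with $p_n,x^n_m\in\omega^\omega$: $\forall n\,(p_n=0^\infty\to\exists m.\ x^n_m=0^\infty)$. It is a complete formula for the class of $\forall^\to\exists\forall$-formulas, i.e. formulas $\forall a[\forall b\,\gamma(a,b,x)\to\exists c\,\forall d\,\theta(a,c,d,x)]$ with $\gamma,\theta$ bounded. A witness for $\langle\forall^\to\exists\forall\rangle(p,x)$ is a partial function $f:\omega\rightharpoonup\omega$ (presented by an element of $\omega^\omega$ enumerating its graph) such that for every $n$ with $p_n=0^\infty$, $f(n)$ is defined and $x^n_{f(n)}=0^\infty$. $\langle\forall\exists\forall\rangle$ is the formula, for instances $y=(y_n(m))_{n,m\in\omega}$ with $y_n(m)\in\omega^\omega$: $\forall n\,\exists m.\ y_n(m)=0^\infty$. A witness for $\langle\forall\exists\forall\rangle(y)$ is a function $f\in\omega^\omega$ with $y_n(f(n))=0^\infty$ for all $n$. (In both cases computably recoverable parts of witnesses are omitted.) $\varphi\le_{\sf m}\psi$ if there are computable functions $\eta,r_-,r_+$ (type-two computable functionals, possibly partial but defined wherever required) such that for every instance $x$ of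 $\varphi$: $\varphi(x)$ is true iff $\psi(\eta(x))$ is true; if $\alpha$ is a witness for $\varphi(x)$ then $r_-(\alpha,x)$ is a witness for $\psi(\eta(x))$; if $\alpha$ is a witness for $\psi(\eta(x))$ then $r_+(\alpha,x)$ is a witness for $\varphi(x)$ (witnesses $\alpha$ are not required to be computable). -}

module Defs where

open import Data.Fin.Base using (Fin)
open import Data.Nat.Base using (ℕ; zero; suc; _+_; _*_; _<_)
open import Data.Product.Base using (_×_; ∃-syntax)
open import Data.Vec.Base using (Vec; []; _∷_; lookup)
open import Data.Vec.Relation.Binary.Pointwise.Inductive using (Pointwise)
open import Function.Bundles using (_⇔_)
open import Relation.Binary.PropositionalEquality.Core using (_≡_)

Baire : Set
Baire = ℕ → ℕ

-- The sequence 0^∞ only ever occurs in equations β = 0^∞, read pointwise.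
_≐0^∞ : Baire → Set
β ≐0^∞ = ∀ i → β i ≡ 0

-- `Rec k n` : programs for partial functions of n numbers that are recursive
-- in k oracles from Baire space (Kleene's μ-recursive functions, relativized).
data Rec (k : ℕ) : ℕ → Set where
  zero   : ∀ {n} → Rec k n
  suc    : Rec k 1
  proj   : ∀ {n} → Fin n → Rec k n
  oracle : Fin k → Rec k 1
  comp   : ∀ {m n} → Rec k m → Vec (Rec k n) m → Rec k n
  prec   : ∀ {n} → Rec k n → Rec k (2 + n) → Rec k (1 + n)
  mu     : ∀ {n} → Rec k (1 + n) → Rec k n

-- `O ⊢ f · xs ⇓ v` : with oracles O, program f halts on input xs with value v.
data _⊢_·_⇓_ {k} (O : Vec Baire k) :
             ∀ {n} → Rec k n → Vec ℕ n → ℕ → Set where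
  zero   : ∀ {n} {xs : Vec ℕ n} → O ⊢ zero · xs ⇓ 0
  suc    : ∀ {x} → O ⊢ suc · (x ∷ []) ⇓ suc x
  proj   : ∀ {n} {xs : Vec ℕ n} (i : Fin n) → O ⊢ proj i · xs ⇓ lookup xs i
  oracle : ∀ {x} (j : Fin k) → O ⊢ oracle j · (x ∷ []) ⇓ lookup O j x
  comp   : ∀ {m n} {f : Rec k m} {gs : Vec (Rec k n) m} {xs ys v} →
           Pointwise (λ g y → O ⊢ g · xs ⇓ y) gs ys →
           O ⊢ f · ys ⇓ v → O ⊢ comp f gs · xs ⇓ v
  prec-z : ∀ {n} {f : Rec k n} {g xs v} →
           O ⊢ f · xs ⇓ v → O ⊢ prec f g · (0 ∷ xs) ⇓ v
  prec-s : ∀ {n} {f : Rec k n} {g xs i u v} →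
           O ⊢ prec f g · (i ∷ xs) ⇓ u → O ⊢ g · (i ∷ u ∷ xs) ⇓ v →
           O ⊢ prec f g · (suc i ∷ xs) ⇓ v
  mu     : ∀ {n} {f : Rec k (1 + n)} {xs y} →
           O ⊢ f · (y ∷ xs) ⇓ 0 →
           (∀ i → i < y → ∃[ u ] O ⊢ f · (i ∷ xs) ⇓ suc u) →
           O ⊢ mu f · xs ⇓ y

-- A program with one number argument and k oracles is a partial computable
-- functional from k-tuples over Baire space to Baire space.
Functional : ℕ → Set
Functional k = Rec k 1

-- `F ⟪ O ⟫↦ β` : F is defined at O, with value β.
_⟪_⟫↦_ : ∀ {k} → Functional k → Vec Baire k → Baire → Set
F ⟪ O ⟫↦ β = ∀ n → O ⊢ F · (n ∷ []) ⇓ β n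

Computable : Baire → Set
Computable x = ∃[ F ] F ⟪ [] ⟫↦ x

-- A formula with one free variable ranging over Baire space, together with
-- its witness relation: `Witness x α` says that α is a witness for the
-- formula at x.
record Formula : Set₁ where
  field
    True    : Baire → Set
    Witness : Baire → Baire → Set

open Formula public

infix 4 _≤ₘ_

-- Only computable x are instances; the value y of η at x is then computable,
-- hence an instance, automatically. The functionals are partial, and the
-- witnesses α are arbitrary.
record _≤ₘ_ (φ ψ : Formula) : Set where
  field
    η     : Functional 1
    r₋ r₊ : Functional 2
    reduces : ∀ x → Computable x →
      ∃[ y ] η ⟪ x ∷ [] ⟫↦ y
           × (True φ x ⇔ True ψ y)
           × (∀ α → Witness φ x α →
                ∃[ β ] r₋ ⟪ α ∷ x ∷ [] ⟫↦ β × Witness ψ y β)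
           × (∀ α → Witness ψ y α →
                ∃[ β ] r₊ ⟪ α ∷ x ∷ [] ⟫↦ β × Witness φ x β)

triangle : ℕ → ℕ
triangle zero    = 0
triangle (suc n) = suc n + triangle n

-- Cantor's bijection ℕ × ℕ → ℕ.
⟨_,_⟩ : ℕ → ℕ → ℕ
⟨ a , b ⟩ = triangle (a + b) + b

-- An instance (p, x) of ⟨∀→∃∀⟩ is coded by z, with the p-part on the even
-- and the x-part on the odd positions: `premise z n` is p_n and
-- `conclusion z n m` is x^n_m.
premise : Baire → ℕ → Baire
premise z n i = z (2 * ⟨ n , i ⟩)

conclusion : Baire → ℕ → ℕ → Baire
conclusion z n m i = z (1 + 2 * ⟨ n , ⟨ m , i ⟩ ⟩)

-- `Enumerates α n v` : the pair (n, v) is listed by α. The value 0 lists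
-- nothing, so that the graph of every partial function can be listed.
Enumerates : Baire → ℕ → ℕ → Set
Enumerates α n v = ∃[ s ] α s ≡ suc ⟨ n , v ⟩

EnumeratesPartialFunction : Baire → Set
EnumeratesPartialFunction α =
  ∀ n v w → Enumerates α n v → Enumerates α n w → v ≡ w

⟨∀→∃∀⟩ : Formula
⟨∀→∃∀⟩ = record
  { True    = λ z → ∀ n → premise z n ≐0^∞ → ∃[ m ] conclusion z n m ≐0^∞
  ; Witness = λ z α →
      EnumeratesPartialFunction α ×
      (∀ n → premise z n ≐0^∞ →
         ∃[ m ] Enumerates α n m × conclusion z n m ≐0^∞)
  }

-- The sequence y_n(m) of an instance y.
component : Baire → ℕ → ℕ → Baire
component y n m i = y ⟨ n , ⟨ m , i ⟩ ⟩

⟨∀∃∀⟩ : Formula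
⟨∀∃∀⟩ = record
  { True    = λ y → ∀ n → ∃[ m ] component y n m ≐0^∞
  ; Witness = λ y f → ∀ n → component y n (f n) ≐0^∞
  }

{-# OPTIONS --safe #-}
-- A program that halts reads only finitely much of its oracles.  Take the zero
-- instance, where every x^n_m vanishes, with the witness n ↦ 0: r₋ sends it to
-- some f₀, and from a finite part σ of f₀ the functional r₊ reads off a value m*
-- with x^0_{m*} = 0^∞.  Now falsify x^0_0 and x^0_{m*} far out.  The finite part σ
-- stays correct: an error of σ would be visible at a finite stage, after which p_0
-- could still be made nonzero, and then n ↦ 0 would again be a witness that r₋
-- sends to an extension of σ.  The new instance is true, so σ extends to a witness
-- of its image, from which r₊ still reads off m*, although now x^0_{m*} ≠ 0^∞.
module Submission where

open import Defs
open import Data.Bool.Base using (if_then_else_)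
open import Data.Empty using (⊥)
open import Data.Fin.Base using (zero)
open import Data.Nat.Base using (ℕ; zero; suc; _+_; _*_; _≤_; _<_; _⊔_; z≤n; s≤s; s≤s⁻¹)
open import Data.Nat.Properties
open import Data.Product.Base using (_×_; _,_; proj₁; proj₂; ∃-syntax)
open import Data.Vec.Base using (Vec; []; _∷_)
open import Data.Vec.Relation.Binary.Pointwise.Inductive as Pointwise using (Pointwise; []; _∷_)
open import Function.Base using (_∘_; const)
open import Relation.Binary.Definitions using (tri<; tri≈; tri>)
open import Relation.Binary.PropositionalEquality.Core
  using (_≡_; _≢_; refl; sym; trans; cong; subst)
open import Relation.Nullary.Decidable.Core using (yes; no; does)
open import Relation.Nullary.Decidable using (dec-true; dec-false)
open import Relation.Nullary.Negation.Core using (¬_; contradiction)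

-- Injectivity of Cantor pairing

triangle-mono-≤ : ∀ {m n} → m ≤ n → triangle m ≤ triangle n
triangle-mono-≤ z≤n       = z≤n
triangle-mono-≤ (s≤s m≤n) = +-mono-≤ (s≤s m≤n) (triangle-mono-≤ m≤n)

-- The pairs with sum `a + b` have their codes between `triangle (a + b)` and
-- `triangle (a + b) + (a + b)`, and the next diagonal starts just after that.
⟨,⟩-mono-< : ∀ a b c d → a + b < c + d → ⟨ a , b ⟩ < ⟨ c , d ⟩
⟨,⟩-mono-< a b c d a+b<c+d = begin-strict
  triangle (a + b) + b       ≤⟨ +-monoʳ-≤ (triangle (a + b)) (m≤n+m b a) ⟩
  triangle (a + b) + (a + b) <⟨ n<1+n _ ⟩
  suc (triangle (a + b) + (a + b)) ≡⟨ cong suc (+-comm (triangle (a + b)) (a + b)) ⟩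
  triangle (suc (a + b))     ≤⟨ triangle-mono-≤ a+b<c+d ⟩
  triangle (c + d)           ≤⟨ m≤m+n _ d ⟩
  ⟨ c , d ⟩                  ∎
  where open ≤-Reasoning

⟨,⟩-injective : ∀ a b c d → ⟨ a , b ⟩ ≡ ⟨ c , d ⟩ → a ≡ c × b ≡ d
⟨,⟩-injective a b c d eq with <-cmp (a + b) (c + d)
... | tri< lt _ _ = contradiction eq (<⇒≢ (⟨,⟩-mono-< a b c d lt))
... | tri> _ _ gt = contradiction (sym eq) (<⇒≢ (⟨,⟩-mono-< c d a b gt))
... | tri≈ _ a+b≡c+d _ = a≡c , b≡d
  where
  b≡d : b ≡ d
  b≡d = +-cancelˡ-≡ (triangle (a + b)) b d
    (trans eq (cong (λ s → triangle s + d) (sym a+b≡c+d)))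
  a≡c : a ≡ c
  a≡c = +-cancelʳ-≡ b a c (trans a+b≡c+d (cong (c +_) (sym b≡d)))

⟨,⟩-upperʳ : ∀ a b → b ≤ ⟨ a , b ⟩
⟨,⟩-upperʳ a b = m≤n+m b (triangle (a + b))

-- Oracle computations: determinism and finite use

uniform-bound : (P : ℕ → ℕ → Set) → (∀ i {M N} → M ≤ N → P i M → P i N) →
  ∀ n → (∀ i → i < n → ∃[ N ] P i N) → ∃[ N ] (∀ i → i < n → P i N)
uniform-bound P mono zero    bound = 0 , λ _ ()
uniform-bound P mono (suc n) bound
  with uniform-bound P mono n (λ i i<n → bound i (m<n⇒m<1+n i<n)) | bound n ≤-refl
... | M , PM | N , PN = M ⊔ N , all
  where
  all : ∀ i → i < suc n → P i (M ⊔ N)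
  all i i<1+n with i ≟ n
  ... | yes refl = mono i (m≤n⊔m M N) PN
  ... | no  i≢n  = mono i (m≤m⊔n M N) (PM i (≤∧≢⇒< (s≤s⁻¹ i<1+n) i≢n))

deterministic : ∀ {k n} {O : Vec Baire k} {f : Rec k n} {xs v w} →
  O ⊢ f · xs ⇓ v → O ⊢ f · xs ⇓ w → v ≡ w
deterministic* : ∀ {k m n} {O : Vec Baire k} {fs : Vec (Rec k n) m} {xs ys zs} →
  Pointwise (λ f y → O ⊢ f · xs ⇓ y) fs ys → Pointwise (λ f z → O ⊢ f · xs ⇓ z) fs zs →
  ys ≡ zs

deterministic zero       zero       = refl
deterministic suc        suc        = refl
deterministic (proj i)   (proj .i)  = refl
deterministic (oracle j) (oracle .j) = refl
deterministic (comp gs f) (comp gs′ f′) with refl ← deterministic* gs gs′ =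
  deterministic f f′
deterministic (prec-z f) (prec-z f′) = deterministic f f′
deterministic (prec-s p g) (prec-s p′ g′) with refl ← deterministic p p′ =
  deterministic g g′
deterministic (mu {y = y} f below) (mu {y = y′} f′ below′) with <-cmp y y′
... | tri≈ _ y≡y′ _ = y≡y′
... | tri< y<y′ _ _ = contradiction (deterministic f (proj₂ (below′ y y<y′))) 0≢1+n
... | tri> _ _ y′<y = contradiction (deterministic (proj₂ (below y′ y′<y)) f′) 1+n≢0

deterministic* []       []         = refl
deterministic* (d ∷ ds) (d′ ∷ ds′)
  with refl ← deterministic d d′ | refl ← deterministic* ds ds′ = refl

AgreeBelow : ℕ → Baire → Baire → Set
AgreeBelow N x y = ∀ i → i < N → x i ≡ y i

AgreeBelow-trans : ∀ {N x y z} → AgreeBelow N x y → AgreeBelow N y z → AgreeBelow N x z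
AgreeBelow-trans x≈y y≈z i i<N = trans (x≈y i i<N) (y≈z i i<N)

AgreeBelow-anti-≤ : ∀ {M N x y} → M ≤ N → AgreeBelow N x y → AgreeBelow M x y
AgreeBelow-anti-≤ M≤N x≈y i i<M = x≈y i (<-≤-trans i<M M≤N)

-- Use is expressed as stability under changes of the oracles from `N` on, not as a record of
-- queries, so enlarging `N` is harmless.
HaltsWithUse : ∀ {k n} → Vec Baire k → Rec k n → Vec ℕ n → ℕ → ℕ → Set
HaltsWithUse O f xs v N = ∀ O′ → Pointwise (AgreeBelow N) O O′ → O′ ⊢ f · xs ⇓ v

HaltsWithUse-mono-≤ : ∀ {k n} {O : Vec Baire k} {f : Rec k n} {xs v M N} →
  M ≤ N → HaltsWithUse O f xs v M → HaltsWithUse O f xs v N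
HaltsWithUse-mono-≤ M≤N h O′ O≈O′ = h O′ (Pointwise.map (AgreeBelow-anti-≤ M≤N) O≈O′)

-- A derivation is finite, even at `mu`, where only arguments up to the result are evaluated; the
-- maximum of the bounds for its parts works.
use : ∀ {k n} {O : Vec Baire k} {f : Rec k n} {xs v} →
  O ⊢ f · xs ⇓ v → ∃[ N ] HaltsWithUse O f xs v N
use* : ∀ {k m n} {O : Vec Baire k} {fs : Vec (Rec k n) m} {xs ys} →
  Pointwise (λ f y → O ⊢ f · xs ⇓ y) fs ys →
  ∃[ N ] Pointwise (λ f y → HaltsWithUse O f xs y N) fs ys

use zero     = 0 , λ _ _ → zero
use suc      = 0 , λ _ _ → suc
use (proj i) = 0 , λ _ _ → proj i
use {O = O} (oracle {x} j) = suc x , λ O′ O≈O′ →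
  subst (O′ ⊢ oracle j · (x ∷ []) ⇓_) (sym (Pointwise.lookup O≈O′ j x ≤-refl)) (oracle j)
use (comp gs f) with use* gs | use f
... | M , gs-use | N , f-use = M ⊔ N , λ O′ O≈O′ →
  comp (Pointwise.map (λ g-use → HaltsWithUse-mono-≤ (m≤m⊔n M N) g-use O′ O≈O′) gs-use)
       (HaltsWithUse-mono-≤ (m≤n⊔m M N) f-use O′ O≈O′)
use (prec-z f) with use f
... | N , f-use = N , λ O′ O≈O′ → prec-z (f-use O′ O≈O′)
use (prec-s p g) with use p | use g
... | M , p-use | N , g-use = M ⊔ N , λ O′ O≈O′ →
  prec-s (HaltsWithUse-mono-≤ (m≤m⊔n M N) p-use O′ O≈O′)
         (HaltsWithUse-mono-≤ (m≤n⊔m M N) g-use O′ O≈O′)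
use {O = O} (mu {f = f} {xs} {y} d below)
  with use d
     | uniform-bound (λ i N → ∃[ u ] HaltsWithUse O f (i ∷ xs) (suc u) N)
         (λ { i M≤N (u , h) → u , HaltsWithUse-mono-≤ M≤N h }) y
         (λ i i<y → let N , h = use (proj₂ (below i i<y)) in N , proj₁ (below i i<y) , h)
... | M , d-use | N , below-use = M ⊔ N , λ O′ O≈O′ →
  mu (HaltsWithUse-mono-≤ (m≤m⊔n M N) d-use O′ O≈O′)
     (λ i i<y → let u , h = below-use i i<y in
                u , HaltsWithUse-mono-≤ (m≤n⊔m M N) h O′ O≈O′)

use* []       = 0 , []
use* (d ∷ ds) with use d | use* ds
... | M , d-use | N , ds-use =
  M ⊔ N , HaltsWithUse-mono-≤ (m≤m⊔n M N) d-use
        ∷ Pointwise.map (HaltsWithUse-mono-≤ (m≤n⊔m M N)) ds-use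

-- Eventually zero sequences as computable instances

constant : ∀ {k n} → ℕ → Rec k n
constant zero    = zero
constant (suc c) = comp suc (constant c ∷ [])

constant-⇓ : ∀ {k n} {O : Vec Baire k} {xs : Vec ℕ n} c → O ⊢ constant c · xs ⇓ c
constant-⇓ zero    = zero
constant-⇓ (suc c) = comp (constant-⇓ c ∷ []) suc

VanishesFrom : ℕ → Baire → Set
VanishesFrom N z = ∀ i → N ≤ i → z i ≡ 0

-- The finitely many values before `N` are hard-wired one at a time: `prec` serves as a case
-- distinction between the head and the tail of `z`.
VanishesFrom⇒Computable : ∀ N z → VanishesFrom N z → Computable z
VanishesFrom⇒Computable zero z z≡0 = zero , λ n → subst ([] ⊢ zero · (n ∷ []) ⇓_) (sym (z≡0 n z≤n)) zero
VanishesFrom⇒Computable (suc N) z z≡0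
  with F , F↦ ← VanishesFrom⇒Computable N (z ∘ suc) (λ i N≤i → z≡0 (suc i) (s≤s N≤i)) =
  G , G↦
  where
  G : Functional 0
  G = prec (constant (z 0)) (comp F (proj zero ∷ []))
  G↦ : G ⟪ [] ⟫↦ z
  G↦ zero    = prec-z (constant-⇓ (z 0))
  G↦ (suc n) = prec-s (G↦ n) (comp (proj zero ∷ []) (F↦ n))

-- Finite modifications and splicing

infixl 6 _[_≔1]

_[_≔1] : Baire → ℕ → Baire
(z [ a ≔1]) i = if does (i ≟ a) then 1 else z i

≔1-updated : ∀ z a → (z [ a ≔1]) a ≡ 1
≔1-updated z a rewrite dec-true (a ≟ a) refl = refl

≔1-minimal : ∀ z {a i} → i ≢ a → (z [ a ≔1]) i ≡ z i
≔1-minimal z {a} {i} i≢a rewrite dec-false (i ≟ a) i≢a = refl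

≔1-agree : ∀ z {a N} → N ≤ a → AgreeBelow N z (z [ a ≔1])
≔1-agree z N≤a i i<N = sym (≔1-minimal z (<⇒≢ (<-≤-trans i<N N≤a)))

≔1-≡0 : ∀ z {a i} → i ≢ a → z i ≡ 0 → (z [ a ≔1]) i ≡ 0
≔1-≡0 z i≢a = trans (≔1-minimal z i≢a)

≔1-vanishes : ∀ {N z} a → VanishesFrom N z → VanishesFrom (N ⊔ suc a) (z [ a ≔1])
≔1-vanishes {N} {z} a z≡0 i N⊔1+a≤i =
  ≔1-≡0 z (>⇒≢ (m⊔n≤o⇒n≤o N (suc a) N⊔1+a≤i)) (z≡0 i (m⊔n≤o⇒m≤o N (suc a) N⊔1+a≤i))

splice : ℕ → Baire → Baire → Baire
splice N f g k = if does (k <? N) then f k else g k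

splice-below : ∀ {N} f g → AgreeBelow N f (splice N f g)
splice-below {N} f g k k<N rewrite dec-true (k <? N) k<N = refl

-- Being a witness is a condition on each value separately, so a correct finite part can be
-- continued by any witness.
splice-witness : ∀ y {N} f g → (∀ k → k < N → component y k (f k) ≐0^∞) →
  Witness ⟨∀∃∀⟩ y g → Witness ⟨∀∃∀⟩ y (splice N f g)
splice-witness y {N} f g f-wit g-wit k with k <? N
... | yes k<N rewrite dec-true (k <? N) k<N = f-wit k k<N
... | no  k≮N rewrite dec-false (k <? N) k≮N = g-wit k

-- Positions in coded instances, and constant witnesses

premiseIndex : ℕ → ℕ → ℕ
premiseIndex n i = 2 * ⟨ n , i ⟩

conclusionIndex : ℕ → ℕ → ℕ → ℕ
conclusionIndex n m i = 1 + 2 * ⟨ n , ⟨ m , i ⟩ ⟩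

premiseIndex≢conclusionIndex : ∀ n i n′ m′ i′ → premiseIndex n i ≢ conclusionIndex n′ m′ i′
premiseIndex≢conclusionIndex n i n′ m′ i′ = even≢odd ⟨ n , i ⟩ ⟨ n′ , ⟨ m′ , i′ ⟩ ⟩

conclusionIndex-injective : ∀ n m i n′ m′ i′ →
  conclusionIndex n m i ≡ conclusionIndex n′ m′ i′ → n ≡ n′ × m ≡ m′
conclusionIndex-injective n m i n′ m′ i′ eq
  with n≡n′ , mi≡ ← ⟨,⟩-injective n _ n′ _ (*-cancelˡ-≡ _ _ 2 (suc-injective eq)) =
  n≡n′ , proj₁ (⟨,⟩-injective m i m′ i′ mi≡)

premiseIndex-upper : ∀ n i → i ≤ premiseIndex n i
premiseIndex-upper n i = ≤-trans (⟨,⟩-upperʳ n i) (m≤n*m _ 2)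

conclusionIndex-upper : ∀ n m i → i ≤ conclusionIndex n m i
conclusionIndex-upper n m i = begin
  i                     ≤⟨ ⟨,⟩-upperʳ m i ⟩
  ⟨ m , i ⟩             ≤⟨ ⟨,⟩-upperʳ n ⟨ m , i ⟩ ⟩
  ⟨ n , ⟨ m , i ⟩ ⟩     ≤⟨ m≤n*m _ 2 ⟩
  2 * ⟨ n , ⟨ m , i ⟩ ⟩ ≤⟨ n≤1+n _ ⟩
  conclusionIndex n m i ∎
  where open ≤-Reasoning

graphOfConst : ℕ → Baire
graphOfConst m s = suc ⟨ s , m ⟩

-- A witness may also be defined where the premise fails, and its value there is unconstrained. So a
-- constant function can stay a witness after a premise has been made false.
graphOfConst-witness : ∀ z m → (∀ n → premise z n ≐0^∞ → conclusion z n m ≐0^∞) →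
  Witness ⟨∀→∃∀⟩ z (graphOfConst m)
graphOfConst-witness z m z-true = single-valued , λ n p≡0 → m , (n , refl) , z-true n p≡0
  where
  value : ∀ n v → Enumerates (graphOfConst m) n v → m ≡ v
  value n v (s , eq) = proj₂ (⟨,⟩-injective s m n v (suc-injective eq))
  single-valued : EnumeratesPartialFunction (graphOfConst m)
  single-valued n v w ev ew = trans (sym (value n v ev)) (value n w ew)

z₀ : Baire
z₀ = const 0

z₀-vanishes : VanishesFrom 0 z₀
z₀-vanishes _ _ = refl

α₀ : Baire
α₀ = graphOfConst 0

-- Refuting a reduction

module _ (reduction : ⟨∀→∃∀⟩ ≤ₘ ⟨∀∃∀⟩) where
  open _≤ₘ_ reduction

  -- The finite part σ is `f₀` below `M`: enough for `r₊` to list `m*` as the value at 0. Below `N`,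
  -- `z₀` and `α₀` determine σ through `r₋`.
  module Spoil {f₀ : Baire} {m* s M N : ℕ} (M≤N : M ≤ N)
    (r₋-use : ∀ k → k < M → HaltsWithUse (α₀ ∷ z₀ ∷ []) r₋ (k ∷ []) (f₀ k) N)
    (r₊-use : HaltsWithUse (f₀ ∷ z₀ ∷ []) r₊ (s ∷ []) (suc ⟨ 0 , m* ⟩) M) where

    z½ z₁ : Baire
    -- The new entries sit at place `N` of their sequences, hence at positions of code at least `N`,
    -- out of sight of both computations.
    z½ = z₀ [ conclusionIndex 0 0 N ≔1]
    z₁ = z½ [ conclusionIndex 0 m* N ≔1]

    z₁-vanishes : ∃[ K ] VanishesFrom K z₁
    z₁-vanishes = _ , ≔1-vanishes _ (≔1-vanishes _ z₀-vanishes)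

    z₁-agree : AgreeBelow N z₀ z₁
    z₁-agree = AgreeBelow-trans (≔1-agree z₀ (conclusionIndex-upper 0 0 N))
                                (≔1-agree z½ (conclusionIndex-upper 0 m* N))

    premise-z₁ : ∀ n → premise z₁ n ≐0^∞
    premise-z₁ n i = ≔1-≡0 z½ (premiseIndex≢conclusionIndex n i 0 m* N)
                    (≔1-≡0 z₀ (premiseIndex≢conclusionIndex n i 0 0 N) refl)

    -- The index `suc m*` differs from both spoiled indices, `0` and `m*`. This keeps `z₁` true.
    conclusion-z₁-suc-m* : ∀ n → conclusion z₁ n (suc m*) ≐0^∞
    conclusion-z₁-suc-m* n i =
      ≔1-≡0 z½ (1+n≢n ∘ proj₂ ∘ conclusionIndex-injective n (suc m*) i 0 m* N)
     (≔1-≡0 z₀ (1+n≢0 ∘ proj₂ ∘ conclusionIndex-injective n (suc m*) i 0 0 N) refl)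

    conclusion-z₁-suc-n : ∀ n m → conclusion z₁ (suc n) m ≐0^∞
    conclusion-z₁-suc-n n m i =
      ≔1-≡0 z½ (1+n≢0 ∘ proj₁ ∘ conclusionIndex-injective (suc n) m i 0 m* N)
     (≔1-≡0 z₀ (1+n≢0 ∘ proj₁ ∘ conclusionIndex-injective (suc n) m i 0 0 N) refl)

    module _ {y₁ : Baire} (η↦y₁ : η ⟪ z₁ ∷ [] ⟫↦ y₁) where

      f₀-correct : ∀ k → k < M → component y₁ k (f₀ k) ≐0^∞
      f₀-correct k k<M i with K , η-use ← use (η↦y₁ ⟨ k , ⟨ f₀ k , i ⟩ ⟩) = y₁≡0
        where
        -- Making p_0 nonzero this far out affects neither the one value of η under inspection (use
        -- `K`) nor the computation of σ (use `N`).
        q : ℕ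
        q = premiseIndex 0 (N ⊔ K)
        N⊔K≤q : N ⊔ K ≤ q
        N⊔K≤q = premiseIndex-upper 0 (N ⊔ K)
        z₂ : Baire
        z₂ = z₁ [ q ≔1]
        -- Row 0 holds vacuously since p_0 is now nonzero; the other rows were never spoiled. Hence
        -- `α₀` is a witness again.
        z₂-true : ∀ n → premise z₂ n ≐0^∞ → conclusion z₂ n 0 ≐0^∞
        z₂-true zero    p≡0   = contradiction (trans (sym (≔1-updated z₁ q)) (p≡0 (N ⊔ K))) 1+n≢0
        z₂-true (suc n) _   j =
          ≔1-≡0 z₁ (premiseIndex≢conclusionIndex 0 (N ⊔ K) (suc n) 0 j ∘ sym)
                   (conclusion-z₁-suc-n n 0 j)
        y₁≡0 : y₁ ⟨ k , ⟨ f₀ k , i ⟩ ⟩ ≡ 0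
        y₁≡0
          with y₂ , η↦y₂ , _ , r₋-reduces , _ ←
                 reduces z₂ (VanishesFrom⇒Computable _ z₂ (≔1-vanishes q (proj₂ z₁-vanishes)))
          with f₂ , r₋↦f₂ , f₂-wit ← r₋-reduces α₀ (graphOfConst-witness z₂ 0 z₂-true) =
          -- The inspected entry is the same in `y₁` and `y₂`, and it lies in a component that the
          -- witness `f₂` selects, so it is 0.
          trans (deterministic
                   (η-use (z₂ ∷ []) (≔1-agree z₁ (m⊔n≤o⇒n≤o N K N⊔K≤q) ∷ []))
                   (η↦y₂ _))
         (trans (cong (λ m → component y₂ k m i) f₀k≡f₂k) (f₂-wit k i))
          where
          f₀k≡f₂k : f₀ k ≡ f₂ k
          f₀k≡f₂k = deterministic
            (r₋-use k k<M (α₀ ∷ z₂ ∷ [])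
              ((λ _ _ → refl) ∷
               AgreeBelow-trans z₁-agree (≔1-agree z₁ (m⊔n≤o⇒m≤o N K N⊔K≤q)) ∷ []))
            (r₋↦f₂ k)

    contradictory : ⊥
    contradictory
      with y₁ , η↦y₁ , _ , r₋-reduces , r₊-reduces ←
             reduces z₁ (VanishesFrom⇒Computable _ z₁ (proj₂ z₁-vanishes))
      -- Any witness for `z₁` would do here: `f₁` only supplies the values from `M` on.
      with f₁ , _ , f₁-wit ← r₋-reduces (graphOfConst (suc m*))
             (graphOfConst-witness z₁ (suc m*) (λ n _ → conclusion-z₁-suc-m* n))
      with β , r₊↦β , single-valued , β-wit ← r₊-reduces (splice M f₀ f₁)
             (splice-witness y₁ f₀ f₁ (f₀-correct η↦y₁) f₁-wit)
      with m , β-lists-m , x≡0 ← β-wit 0 (premise-z₁ 0)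
      -- On the spliced witness `r₊` sees only σ and a part of `z₁` that agrees with `z₀`, so it
      -- lists `m*` at stage `s` as before; single-valuedness forces `m` to be `m*`.
      with refl ← single-valued 0 m m* β-lists-m
             (s , deterministic (r₊↦β s)
                    (r₊-use (splice M f₀ f₁ ∷ z₁ ∷ []) (splice-below f₀ f₁ ∷ AgreeBelow-anti-≤ M≤N z₁-agree ∷ [])))
      = 1+n≢0 (trans (sym (≔1-updated z½ (conclusionIndex 0 m* N))) (x≡0 N))

theorem4p17 : ¬ (⟨∀→∃∀⟩ ≤ₘ ⟨∀∃∀⟩)
theorem4p17 reduction
  with y₀ , _ , _ , r₋-reduces , r₊-reduces ←
         _≤ₘ_.reduces reduction z₀ (VanishesFrom⇒Computable 0 z₀ z₀-vanishes)
  with f₀ , r₋↦f₀ , f₀-wit ← r₋-reduces α₀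
         (graphOfConst-witness z₀ 0 (λ _ _ _ → refl))
  with β , r₊↦β , _ , β-wit ← r₊-reduces f₀ f₀-wit
  -- One output of `r₊`, at the stage `s` that lists `m*` for 0, is all that has to be preserved.
  with m* , (s , βs≡) , _ ← β-wit 0 (λ _ → refl)
  with M , r₊-use ← use (subst (_ ⊢ _ · _ ⇓_) βs≡ (r₊↦β s))
  with N , r₋-use ← uniform-bound
         (λ k → HaltsWithUse (α₀ ∷ z₀ ∷ []) (_≤ₘ_.r₋ reduction) (k ∷ []) (f₀ k))
         (λ _ → HaltsWithUse-mono-≤) M (λ k _ → use (r₋↦f₀ k)) =
  -- The maximum `M ⊔ N` covers both uses of `z₀`: by `r₊` at `s` and by `r₋` on the arguments below
  -- `M`.
  Spoil.contradictory reduction {f₀} {m*} {s} (m≤m⊔n M N)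
    (λ k k<M → HaltsWithUse-mono-≤ (m≤n⊔m M N) (r₋-use k k<M)) r₊-use
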